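{- Let $p$ be a positive integer, let $T$ be a complete rooted ternary tree, and let $H$ be a connected graph with at least $2p$ vertices. Let $V\subseteq V(T(H))$ with $|OC(T,V)|\ge p$, let $x=tr(|OC(T,V)|)$, and let $SV$ be a permutation of $V$. Then $T(H)$ has a witnessing matching for $SV$ of size at least $p\cdot\lfloor (x-tr(p))/2\rfloor$.
   Context: For a tree $T$ and a graph $H$ with $V(H)=\{1,\dots,m\}$, the graph $T(H)$ is the disjoint union of copies $H^v$ of $H$, one for each $v\in V(T)$ (the copy of vertex $i$ in $H^v$ is denoted $v^i$), together with an edge $\{u^i,v^i\}$ for every $i$ and every edge $\{u,v\}$ of $T$. For $V\subseteq V(T(H))$, a vertex $u\in V(T)$ is occupied by $V$ if $V(H^u)\cap V\ne\emptyset$, and $OC(T,V)$ is the set of vertices of $T$ occupied by $V$. A complete rooted ternary tree of height $h$ is a rooted tree in which every non-leaf vertex has exactly 3 children and every root-leaf path has exactly $h$ edges. For a real $x\ge 1$, $tr(x)$ is the largest $h$ such that $x$ is at least the number of vertices of a complete rooted ternary tree of height $h$. Given a graph $G$, $V\subseteq V(G)$ and a permutation $SV$ of $V$, split $SV$ into a prefix $SV_1$ and the complementary suffix $SV_2$ (either may be empty). An edge $\{u,v\}$ of $G$ is supported by $(SV_1,SV_2)$ if either one end is in $SV_1$ and the other in $SV_2$, or one end is in $V$ and the other in $V(G)\setminus V$. A matching is supported by $(SV_1,SV_2)$ if all its edges are; a matching of $G$ is a witnessing matching for $SV$ if it is supported by some such prefix/suffix split of $SV$. -}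

module Defs where

open import Data.Nat using (ℕ; zero; suc; _+_; _*_; _≤_)
open import Data.Fin using (Fin) renaming (_≟_ to _≟F_)
open import Data.List using (List; []; _∷_; _∷ʳ_; length; map; deduplicate; _++_; concatMap)
open import Data.List.Properties using (≡-dec)
open import Data.List.Membership.Propositional using (_∈_; _∉_)
open import Data.List.Relation.Unary.All using (All)
open import Data.List.Relation.Unary.Unique.Propositional using (Unique)
open import Data.Product using (Σ; _×_; _,_; proj₁; proj₂; ∃; ∃-syntax)
open import Data.Sum using (_⊎_)
open import Relation.Binary.PropositionalEquality using (_≡_)
open import Relation.Nullary using (¬_)

record Graph (m : ℕ) : Set₁ where
  field
    Adj    : Fin m → Fin m → Set
    sym    : ∀ {i j} → Adj i j → Adj j i
    irrefl : ∀ {i} → ¬ Adj i i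
open Graph public

data Path {m : ℕ} (H : Graph m) : Fin m → Fin m → Set where
  here : ∀ {i} → Path H i i
  step : ∀ {i j k} → Adj H i j → Path H j k → Path H i k

Connected : {m : ℕ} → Graph m → Set
Connected H = ∀ i j → Path H i j

-- The complete rooted ternary tree of height h.
-- Vertices are addresses: lists over {0,1,2} of length ≤ h (the root is []);
-- the children of w are w ∷ʳ c for c : Fin 3.

TVertex : ℕ → Set
TVertex h = Σ (List (Fin 3)) (λ w → length w ≤ h)

TAdj : {h : ℕ} → TVertex h → TVertex h → Set
TAdj (u , _) (v , _) = (∃[ c ] v ≡ u ∷ʳ c) ⊎ (∃[ c ] u ≡ v ∷ʳ c)

ternarySize : ℕ → ℕ
ternarySize zero    = 1
ternarySize (suc h) = 1 + 3 * ternarySize h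

IsTr : ℕ → ℕ → Set
IsTr x h = ternarySize h ≤ x × (∀ h' → ternarySize h' ≤ x → h' ≤ h)

-- The graph T(H), T the complete ternary tree of height h.
-- Vertex (u , i) is the copy u^i of vertex i in H^u.

TH-Vertex : ℕ → ℕ → Set
TH-Vertex h m = TVertex h × Fin m

TH-Adj : {h m : ℕ} → Graph m → TH-Vertex h m → TH-Vertex h m → Set
TH-Adj H (u , i) (v , j) = (u ≡ v × Adj H i j) ⊎ (i ≡ j × TAdj u v)

-- |OC(T,V)| where V is the set of entries of the list SV
occupiedCount : {h m : ℕ} → List (TH-Vertex h m) → ℕ
occupiedCount SV =
  length (deduplicate (≡-dec _≟F_) (map (λ x → proj₁ (proj₁ x)) SV))

Edge : ℕ → ℕ → Set
Edge h m = TH-Vertex h m × TH-Vertex h m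

endpoints : {h m : ℕ} → List (Edge h m) → List (TH-Vertex h m)
endpoints = concatMap (λ e → proj₁ e ∷ proj₂ e ∷ [])

IsMatching : {h m : ℕ} → Graph m → List (Edge h m) → Set
IsMatching H M = All (λ e → TH-Adj H (proj₁ e) (proj₂ e)) M × Unique (endpoints M)

-- edge {a,b} supported by (SV₁ , SV₂), where V = SV₁ ++ SV₂ as a set
SupportedEdge : {h m : ℕ} → List (TH-Vertex h m) → List (TH-Vertex h m) → Edge h m → Set
SupportedEdge SV₁ SV₂ (a , b) =
    (a ∈ SV₁ × b ∈ SV₂) ⊎ (a ∈ SV₂ × b ∈ SV₁)
  ⊎ (a ∈ (SV₁ ++ SV₂) × b ∉ (SV₁ ++ SV₂)) ⊎ (a ∉ (SV₁ ++ SV₂) × b ∈ (SV₁ ++ SV₂))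

Witnessing : {h m : ℕ} → Graph m → List (TH-Vertex h m) → List (Edge h m) → Set
Witnessing H SV M =
  IsMatching H M ×
  (∃[ SV₁ ] ∃[ SV₂ ] (SV ≡ SV₁ ++ SV₂ × All (SupportedEdge SV₁ SV₂) M))

{-# OPTIONS --safe #-}
module Submission where

-- Colour a vertex of T(H) by whether it lies in the prefix, in the suffix or outside V; an edge
-- is supported iff it is bichromatic. A copy of H that is not monochromatic contains a bichromatic
-- edge, and two copies that differ in every layer yield |H| ≥ 2p disjoint bichromatic edges along
-- the tree path between them.
--
-- The bound is proved by induction, gaining p edges whenever x grows by 2. Let N be the size of a
-- ternary tree of height x - 2. If some copy is unoccupied, there is a subtree with between N and
-- 3N occupied copies that leaves an unoccupied copy outside; the induction hypothesis applies to
-- the subtree, and outside of it at least p occupied copies face an unoccupied one.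
--
-- If every copy is occupied, call a time balanced if at least p copies are not entirely in the
-- prefix and at least p are not entirely in the suffix. Each of the three child subtrees has a
-- balanced time with a large matching; at the middle one of the three times, the other two
-- subtrees together with the root are balanced and contribute p further edges.

open import Defs hiding (sym) renaming (here to stay)
open import Data.Bool using (Bool; true; false; not)
open import Data.Bool.Properties using (T-≡) renaming (_≟_ to _≟B_)
open import Data.Fin using (Fin; zero; suc) renaming (_≟_ to _≟F_)
import Data.Fin.Properties as Fin
open import Data.List using (List; []; _∷_; _∷ʳ_; _++_; length; map; filter; deduplicate; tabulate; take; drop)
open import Data.List.Membership.Propositional using (_∈_; _∉_)
open import Data.List.Membership.Propositional.Properties using (∈-∃++; ∈-++⁻; ∈-++⁺ˡ; ∈-++⁺ʳ; ∈-map⁺; ∈-map⁻; ∈-filter⁺; ∈-filter⁻; ∈-deduplicate⁻)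
open import Data.List.Properties using (≡-dec; length-++; length-++-sucʳ; length-++-≤ˡ; length-map; length-tabulate; filter-++; filter-all; length-filter; ++-assoc; ++-cancelˡ; ∷-injectiveʳ; take++drop≡id)
open import Data.List.Relation.Unary.All as All using (All; []; _∷_)
import Data.List.Relation.Unary.All.Properties as All
open import Data.List.Relation.Unary.AllPairs as AllPairs using (AllPairs; []; _∷_)
import Data.List.Relation.Unary.AllPairs.Properties as AllPairs
open import Data.List.Relation.Unary.Any using (here; there)
open import Data.List.Relation.Unary.Unique.DecPropositional.Properties using (deduplicate-!)
open import Data.List.Relation.Unary.Unique.Propositional using (Unique)
import Data.List.Relation.Unary.Unique.Propositional.Properties as Unique
open import Data.Maybe as Maybe using (Maybe; just; nothing; Is-just)
import Data.Maybe.Properties as Maybe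
import Data.Maybe.Relation.Unary.Any as MaybeAny
open import Data.Nat using (ℕ; zero; suc; _+_; _*_; _∸_; _≤_; _<_; _/_; _<ᵇ_; _≤?_; _<?_; z≤n; s≤s)
open import Data.Nat.DivMod using (m/n*n≤m)
open import Data.Nat.Properties
open import Data.Nat.Solver using (module +-*-Solver)
open import Data.Product using (_×_; _,_; proj₁; proj₂; ∃₂; ∃-syntax; map₂)
import Data.Product.Properties as Product
open import Data.Sum as Sum using (_⊎_; inj₁; inj₂; [_,_]′)
open import Data.Unit using (tt)
open import Function using (_∘_; id)
open import Function.Bundles using (Equivalence)
open import Relation.Binary.PropositionalEquality using (_≡_; _≢_; refl; sym; trans; cong; cong₂; subst)
open import Relation.Nullary using (¬_; Dec; yes; no; contradiction; ¬?)
open import Relation.Nullary.Decidable using (map′; _×-dec_)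
open import Relation.Unary using (Decidable)

-- Counting with duplicate-free and filtered lists.

unique-⊆⇒length≤ : {A : Set} {xs ys : List A} → Unique xs →
  (∀ {x} → x ∈ xs → x ∈ ys) → length xs ≤ length ys
unique-⊆⇒length≤ [] _ = z≤n
unique-⊆⇒length≤ {xs = x ∷ xs} (x∉xs ∷ xs!) xs⊆ys with ∈-∃++ (xs⊆ys (here refl))
... | ys₁ , ys₂ , refl = subst (suc (length xs) ≤_) (sym (length-++-sucʳ ys₁ x ys₂))
  (s≤s (unique-⊆⇒length≤ xs! drop-x))
  where
  drop-x : ∀ {y} → y ∈ xs → y ∈ ys₁ ++ ys₂
  drop-x y∈xs with ∈-++⁻ ys₁ (xs⊆ys (there y∈xs))
  ... | inj₁ y∈ys₁           = ∈-++⁺ˡ y∈ys₁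
  ... | inj₂ (here refl)     = contradiction refl (All.lookup x∉xs y∈xs)
  ... | inj₂ (there y∈ys₂)   = ∈-++⁺ʳ ys₁ y∈ys₂

module _ {A : Set} {P : A → Set} (P? : Decidable P) where

  length-filter-∁ : ∀ xs → length xs ≡ length (filter P? xs) + length (filter (¬? ∘ P?) xs)
  length-filter-∁ []       = refl
  length-filter-∁ (x ∷ xs) with P? x
  ... | yes _ = cong suc (length-filter-∁ xs)
  ... | no  _ = trans (cong suc (length-filter-∁ xs)) (sym (+-suc _ _))

  length-filter-map : {B : Set} (f : B → A) → ∀ xs →
    length (filter P? (map f xs)) ≡ length (filter (λ x → P? (f x)) xs)
  length-filter-map f []       = refl
  length-filter-map f (x ∷ xs) with P? (f x)
  ... | yes _ = cong suc (length-filter-map f xs)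
  ... | no  _ = length-filter-map f xs

  length-filter-∷ : ∀ x xs → length (filter P? (x ∷ xs)) ≤ suc (length (filter P? xs))
  length-filter-∷ x xs with P? x
  ... | yes _ = ≤-refl
  ... | no  _ = n≤1+n _

-- Separates the two sources of matchings: if every listed copy is mixed, each contributes an edge
-- of its own; otherwise a single exceptional copy is handed over for a layer-by-layer argument.
all-or-one : {A : Set} {P Q R : A → Set} {xs : List A} →
  All (λ x → R x × (P x ⊎ Q x)) xs → All (λ x → R x × P x) xs ⊎ ∃[ x ] (R x × Q x)
all-or-one []                    = inj₁ []
all-or-one ((r , inj₂ q) ∷ _)    = inj₂ (_ , r , q)
all-or-one ((r , inj₁ p) ∷ pqs) with all-or-one pqs
... | inj₁ ps = inj₁ ((r , p) ∷ ps)
... | inj₂ q  = inj₂ q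

-- Nodes of the ternary tree

Node : Set
Node = List (Fin 3)

_⊑_ : Node → Node → Set
w ⊑ z = ∃[ y ] z ≡ w ++ y

⊑-trans : ∀ {x y z} → x ⊑ y → y ⊑ z → x ⊑ z
⊑-trans {x} (a , refl) (b , refl) = a ++ b , ++-assoc x a b

_⊑?_ : ∀ w z → Dec (w ⊑ z)
[]      ⊑? z       = yes (z , refl)
(c ∷ w) ⊑? []      = no λ ()
(c ∷ w) ⊑? (d ∷ z) = map′ (λ { (refl , y , refl) → y , refl }) (λ { (y , refl) → refl , y , refl })
                          ((c ≟F d) ×-dec (w ⊑? z))

Within : ℕ → Node → Set
Within h z = length z ≤ h

-- Such a region contains, with each node, the whole path to the root, so the tree path via the root
-- between two of its nodes never leaves it.
PrefixClosed : (Node → Set) → Set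
PrefixClosed R = ∀ {y z} → y ⊑ z → R z → R y

within-closed : ∀ {h} → PrefixClosed (Within h)
within-closed {y = y} (_ , refl) = ≤-trans (length-++-≤ˡ y)

Outside : ℕ → Node → Node → Set
Outside h w z = Within h z × ¬ w ⊑ z

-- An ancestor of z lying below w would put z itself below w. Removing a subtree therefore keeps the
-- remaining nodes joined through the root.
outside-closed : ∀ {h w} → PrefixClosed (Outside h w)
outside-closed y⊑z (z≤h , w⋢z) = within-closed y⊑z z≤h , λ w⊑y → w⋢z (⊑-trans w⊑y y⊑z)

nodes : ℕ → List Node
children : ℕ → List Node

nodes zero    = [] ∷ []
nodes (suc h) = [] ∷ children h

children h = map (zero ∷_) (nodes h) ++ (map (suc zero ∷_) (nodes h) ++ map (suc (suc zero) ∷_) (nodes h))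

∈-children⁺ : ∀ {h z} c → z ∈ nodes h → (c ∷ z) ∈ children h
∈-children⁺ zero             z∈ = ∈-++⁺ˡ (∈-map⁺ _ z∈)
∈-children⁺ {h} (suc zero)       z∈ = ∈-++⁺ʳ (map (zero ∷_) (nodes h)) (∈-++⁺ˡ (∈-map⁺ _ z∈))
∈-children⁺ {h} (suc (suc zero)) z∈ =
  ∈-++⁺ʳ (map (zero ∷_) (nodes h)) (∈-++⁺ʳ (map (suc zero ∷_) (nodes h)) (∈-map⁺ _ z∈))

nodes-complete : ∀ h {z} → Within h z → z ∈ nodes h
nodes-complete zero    {[]}    _         = here refl
nodes-complete (suc h) {[]}    _         = here refl
nodes-complete (suc h) {c ∷ z} (s≤s z≤h) = there (∈-children⁺ {h} c (nodes-complete h z≤h))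

nodes-within : ∀ h → All (Within h) (nodes h)
nodes-within zero    = z≤n ∷ []
nodes-within (suc h) = z≤n ∷ All.++⁺ deeper (All.++⁺ deeper deeper)
  where
  deeper : ∀ {c} → All (Within (suc h)) (map (c ∷_) (nodes h))
  deeper = All.map⁺ (All.map s≤s (nodes-within h))

nodes-unique : ∀ h → Unique (nodes h)
nodes-unique zero    = [] ∷ []
nodes-unique (suc h) = All.++⁺ root≢ (All.++⁺ root≢ root≢) ∷
  Unique.++⁺ shifted (Unique.++⁺ shifted shifted (apart λ ()))
    λ { (z∈ , z∈′) → [ (λ z∈₁ → apart (λ ()) (z∈ , z∈₁)) , (λ z∈₂ → apart (λ ()) (z∈ , z∈₂)) ]′
                       (∈-++⁻ (map (suc zero ∷_) (nodes h)) z∈′) }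
  where
  root≢ : ∀ {c} → All ([] ≢_) (map (c ∷_) (nodes h))
  root≢ = All.map⁺ (All.universal (λ _ ()) (nodes h))
  shifted : ∀ {c} → Unique (map (c ∷_) (nodes h))
  shifted = Unique.map⁺ ∷-injectiveʳ (nodes-unique h)
  apart : ∀ {c d z} → c ≢ d → ¬ (z ∈ map (c ∷_) (nodes h) × z ∈ map (d ∷_) (nodes h))
  apart c≢d (z∈ , z∈′) with ∈-map⁻ _ z∈ | ∈-map⁻ _ z∈′
  ... | _ , _ , refl | _ , _ , refl = c≢d refl

length-nodes : ∀ h → length (nodes h) ≡ ternarySize h
length-nodes zero    = refl
length-nodes (suc h) = cong suc (trans (length-++ (map (zero ∷_) ns)) (cong₂ _+_ shifted
  (trans (length-++ (map (suc zero ∷_) ns)) (cong₂ _+_ shifted (trans shifted (sym (+-identityʳ _)))))))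
  where
  ns = nodes h
  shifted : ∀ {c} → length (map (c ∷_) ns) ≡ ternarySize h
  shifted = trans (length-map _ ns) (length-nodes h)

count : {P : Node → Set} → Decidable P → ℕ → ℕ
count P? h = length (filter P? (nodes h))

module _ {P : Node → Set} (P? : Decidable P) where

  filter-nodes-unique : ∀ h → Unique (filter P? (nodes h))
  filter-nodes-unique h = Unique.filter⁺ P? (nodes-unique h)

  filter-nodes-all : ∀ h → All (λ z → Within h z × P z) (filter P? (nodes h))
  filter-nodes-all h = All.zip (All.filter⁺ P? (nodes-within h) , All.all-filter P? (nodes h))

  length≤count : ∀ {h xs} → Unique xs → All (λ z → Within h z × P z) xs → length xs ≤ count P? h
  length≤count {h} xs! xsP = unique-⊆⇒length≤ xs! λ x∈xs →
    let (x≤h , Px) = All.lookup xsP x∈xs in ∈-filter⁺ P? (nodes-complete h x≤h) Px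

  count-∷≤count : ∀ h c → count (λ z → P? (c ∷ z)) h ≤ count P? (suc h)
  count-∷≤count h c = subst (_≤ count P? (suc h)) (length-map (c ∷_) zs) (length≤count
    (Unique.map⁺ ∷-injectiveʳ (Unique.filter⁺ _ (nodes-unique h)))
    (All.map⁺ (All.map (λ (z≤h , Pz) → s≤s z≤h , Pz)
      (All.zip (All.filter⁺ _ (nodes-within h) , All.all-filter _ (nodes h))))))
    where zs = filter (λ z → P? (c ∷ z)) (nodes h)

  count-suc : ∀ h → count P? (suc h) ≤
    1 + (count (λ z → P? (zero ∷ z)) h + (count (λ z → P? (suc zero ∷ z)) h + count (λ z → P? (suc (suc zero) ∷ z)) h))
  count-suc h = ≤-trans (length-filter-∷ P? [] (children h)) (≤-reflexive (cong suc
    (trans (split (map (zero ∷_) ns) _) (cong₂ _+_ (length-filter-map P? _ ns)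
      (trans (split (map (suc zero ∷_) ns) _) (cong₂ _+_ (length-filter-map P? _ ns) (length-filter-map P? _ ns)))))))
    where
    ns = nodes h
    split : ∀ xs ys → length (filter P? (xs ++ ys)) ≡ length (filter P? xs) + length (filter P? ys)
    split xs ys = trans (cong length (filter-++ P? xs ys)) (length-++ (filter P? xs))

  count≤size : ∀ h → count P? h ≤ ternarySize h
  count≤size h = subst (count P? h ≤_) (length-nodes h) (length-filter P? (nodes h))

  count-all : ∀ h → (∀ z → Within h z → P z) → count P? h ≡ ternarySize h
  count-all h all = trans (cong length (filter-all P? (All.map (all _) (nodes-within h)))) (length-nodes h)

  all-or-missing : ∀ h → (∀ z → Within h z → P z) ⊎ ∃[ z ] (Within h z × ¬ P z)
  all-or-missing h with All.all? P? (nodes h)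
  ... | yes all = inj₁ λ z z≤h → All.lookup all (nodes-complete h z≤h)
  ... | no ¬all with All.lookupAny (nodes-within h) (All.¬All⇒Any¬ P? (nodes h) ¬all)
  ...   | z≤h , ¬Pz = inj₂ (_ , z≤h , ¬Pz)

  missing : ∀ h → count P? h < ternarySize h → ∃[ z ] (Within h z × ¬ P z)
  missing h lt with all-or-missing h
  ... | inj₁ all = contradiction (count-all h all) (<⇒≢ lt)
  ... | inj₂ z   = z

  count-∁ : ∀ h → ternarySize h ≡ count P? h + count (¬? ∘ P?) h
  count-∁ h = trans (sym (length-nodes h)) (length-filter-∁ P? (nodes h))

  filter-outside : ℕ → Node → List Node
  filter-outside h w = filter (¬? ∘ (w ⊑?_)) (filter P? (nodes h))

  -- The nodes below w have the form w ++ y, and cancelling the length of w leaves y with length at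
  -- most h.
  count≤inside+outside : ∀ w h →
    count P? (length w + h) ≤ count (λ z → P? (w ++ z)) h + length (filter-outside (length w + h) w)
  count≤inside+outside w h = ≤-trans (≤-reflexive (length-filter-∁ (w ⊑?_) Ps)) (+-monoˡ-≤ _ inside)
    where
    Ps = filter P? (nodes (length w + h))
    Is = filter (λ z → P? (w ++ z)) (nodes h)
    inside : length (filter (w ⊑?_) Ps) ≤ length Is
    inside = subst (length (filter (w ⊑?_) Ps) ≤_) (length-map (w ++_) Is) (unique-⊆⇒length≤
      (Unique.filter⁺ _ (filter-nodes-unique (length w + h)))
      reindex)
      where
      reindex : ∀ {z} → z ∈ filter (w ⊑?_) Ps → z ∈ map (w ++_) Is
      reindex z∈ with ∈-filter⁻ (w ⊑?_) z∈
      ... | z∈Ps , y , refl with All.lookup (filter-nodes-all (length w + h)) z∈Ps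
      ...   | wy≤ , Pwy = ∈-map⁺ (w ++_) (∈-filter⁺ _ (nodes-complete h
                (+-cancelˡ-≤ (length w) _ _ (subst (_≤ length w + h) (length-++ w) wy≤))) Pwy)

  outside-all : ∀ h w → All (λ z → Outside h w z × P z) (filter-outside h w)
  outside-all h w = All.map (λ ((z≤h , Pz) , w⋢z) → (z≤h , w⋢z) , Pz)
    (All.zip (All.filter⁺ _ (filter-nodes-all h) , All.all-filter (¬? ∘ (w ⊑?_)) (filter P? (nodes h))))

count-mono : {P Q : Node → Set} (P? : Decidable P) (Q? : Decidable Q) → (∀ {z} → P z → Q z) →
  ∀ h → count P? h ≤ count Q? h
count-mono P? Q? P⊆Q h = length≤count Q? (filter-nodes-unique P? h)
  (All.map (map₂ P⊆Q) (filter-nodes-all P? h))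

-- Bichromatic matchings

-- Addresses carry no length bound here. The height enters through a region such as `Within h`, so
-- that passing to a subtree amounts to prefixing an address.
Point : ℕ → Set
Point m = Node × Fin m

Colouring : ℕ → Set
Colouring m = Point m → Maybe Bool

_≟C_ : (a b : Maybe Bool) → Dec (a ≡ b)
_≟C_ = Maybe.≡-dec _≟B_

Mixed : ∀ {m} → Colouring m → Node → Set
Mixed c z = ∃₂ λ i j → c (z , i) ≢ c (z , j)

-- Walking down from the root to u, the value must change on some edge. The lower end of that edge
-- is a prefix of u, which keeps the edge inside every prefix-closed region containing u.
bichromatic-descent : (f : Node → Maybe Bool) → ∀ u → f [] ≢ f u →
  ∃₂ λ z d → (z ∷ʳ d) ⊑ u × f z ≢ f (z ∷ʳ d)
bichromatic-descent f []      neq = contradiction refl neq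
bichromatic-descent f (d ∷ u) neq with f [] ≟C f (d ∷ [])
... | no  f[]≢fd = [] , d , (u , refl) , f[]≢fd
... | yes f[]≡fd with bichromatic-descent (f ∘ (d ∷_)) u (neq ∘ trans f[]≡fd)
...   | z , e , (y , refl) , fz≢ = d ∷ z , e , (y , refl) , fz≢

module _ {m : ℕ} (H : Graph m) where

  PointAdj : Point m → Point m → Set
  PointAdj (u , i) (v , j) =
    (u ≡ v × Adj H i j) ⊎ (i ≡ j × ((∃[ c ] v ≡ u ∷ʳ c) ⊎ (∃[ c ] u ≡ v ∷ʳ c)))

  BichromaticEdge : (Node → Set) → Colouring m → Point m × Point m → Set
  BichromaticEdge R c (a , b) = PointAdj a b × c a ≢ c b × R (proj₁ a) × R (proj₁ b)

  -- Only ends of different edges are compared: the two ends of one edge are distinct already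
  -- because their colours differ.
  Apart : Point m × Point m → Point m × Point m → Set
  Apart (a , b) (a′ , b′) = a ≢ a′ × a ≢ b′ × b ≢ a′ × b ≢ b′

  record Matching (R : Node → Set) (c : Colouring m) (k : ℕ) : Set where
    field
      edges : List (Point m × Point m)
      good  : All (BichromaticEdge R c) edges
      apart : AllPairs Apart edges
      size  : k ≤ length edges

  open Matching public

  empty-matching : ∀ {R c} → Matching R c 0
  empty-matching = record { edges = [] ; good = [] ; apart = [] ; size = z≤n }

  weaken : ∀ {R R′ c k k′} → (∀ {z} → R z → R′ z) → k′ ≤ k → Matching R c k → Matching R′ c k′
  weaken R⊆R′ k′≤k M = record
    { edges = edges M
    ; good  = All.map (λ (adj , a≢b , Ra , Rb) → adj , a≢b , R⊆R′ Ra , R⊆R′ Rb) (good M)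
    ; apart = apart M
    ; size  = ≤-trans k′≤k (size M)
    }

  union : ∀ {R₁ R₂ R c k₁ k₂} → (∀ {z} → R₁ z → R z) → (∀ {z} → R₂ z → R z) →
    (∀ {z} → R₁ z → ¬ R₂ z) → Matching R₁ c k₁ → Matching R₂ c k₂ → Matching R c (k₁ + k₂)
  union {R₁} {R₂} R₁⊆R R₂⊆R disjoint M₁ M₂ = record
    { edges = edges M₁ ++ edges M₂
    ; good  = All.++⁺ (good (weaken R₁⊆R ≤-refl M₁)) (good (weaken R₂⊆R ≤-refl M₂))
    ; apart = AllPairs.++⁺ (apart M₁) (apart M₂) (All.map (λ (_ , _ , Ra , Rb) →
        All.map (λ (_ , _ , Ra′ , Rb′) → differ Ra Ra′ , differ Ra Rb′ , differ Rb Ra′ , differ Rb Rb′)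
          (good M₂)) (good M₁))
    ; size  = ≤-trans (+-mono-≤ (size M₁) (size M₂)) (≤-reflexive (sym (length-++ (edges M₁))))
    }
    where
    differ : ∀ {a b : Point m} → R₁ (proj₁ a) → R₂ (proj₁ b) → a ≢ b
    differ R₁a R₂b refl = disjoint R₁a R₂b

  -- Prefixing w is injective and preserves adjacency, so a matching found recursively in the
  -- subtree at w is one of the whole tree, confined to that subtree.
  graft : ∀ {R c k} w → Matching R (λ x → c (w ++ proj₁ x , proj₂ x)) k →
    Matching (λ z → ∃[ y ] (R y × z ≡ w ++ y)) c k
  graft {R} {c} w M = record
    { edges = map lift₂ (edges M)
    ; good  = All.map⁺ (All.map
        (λ (adj , a≢b , Ra , Rb) → lift-adj adj , a≢b , (_ , Ra , refl) , (_ , Rb , refl)) (good M))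
    ; apart = AllPairs.map⁺ (AllPairs.map
        (λ (p , q , r , s) → p ∘ lift-injective , q ∘ lift-injective , r ∘ lift-injective , s ∘ lift-injective) (apart M))
    ; size  = ≤-trans (size M) (≤-reflexive (sym (length-map lift₂ (edges M))))
    }
    where
    lift : Point m → Point m
    lift x = w ++ proj₁ x , proj₂ x
    lift₂ : Point m × Point m → Point m × Point m
    lift₂ (a , b) = lift a , lift b
    lift-injective : ∀ {a b} → lift a ≡ lift b → a ≡ b
    lift-injective eq = cong₂ _,_ (++-cancelˡ w _ _ (cong proj₁ eq)) (cong proj₂ eq)
    lift-adj : ∀ {a b} → PointAdj a b → PointAdj (lift a) (lift b)
    lift-adj (inj₁ (refl , adj))             = inj₁ (refl , adj)
    lift-adj (inj₂ (i≡j , inj₁ (d , refl))) = inj₂ (i≡j , inj₁ (d , sym (++-assoc w _ _)))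
    lift-adj (inj₂ (i≡j , inj₂ (d , refl))) = inj₂ (i≡j , inj₂ (d , sym (++-assoc w _ _)))

  bichromatic-step : (f : Fin m → Maybe Bool) → ∀ {i j} → Path H i j → f i ≢ f j →
    ∃₂ λ a b → Adj H a b × f a ≢ f b
  bichromatic-step f stay fi≢fi = contradiction refl fi≢fi
  bichromatic-step f (step {i} {j} adj path) fi≢fk with f i ≟C f j
  ... | yes fi≡fj = bichromatic-step f path (fi≢fk ∘ trans fi≡fj)
  ... | no  fi≢fj = i , j , adj , fi≢fj

  -- Each mixed copy contains a bichromatic edge of its own because H is connected.
  mixed-matching : Connected H → ∀ {R c zs} → Unique zs → All (λ z → R z × Mixed c z) zs →
    Matching R c (length zs)
  mixed-matching conn {R} {c} zs! zsM =
    -- The induction works in the region `_∈ zs`, which makes the edge in the head copy disjoint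
    -- from all later ones; only the result is widened to `R`.
    weaken (λ z∈zs → proj₁ (All.lookup zsM z∈zs)) ≤-refl (go zs! (All.map proj₂ zsM))
    where
    go : ∀ {zs} → Unique zs → All (Mixed c) zs → Matching (_∈ zs) c (length zs)
    go [] [] = empty-matching
    go {z ∷ zs} (z∉zs ∷ zs!) ((i , j , ci≢cj) ∷ zsM)
      with bichromatic-step (λ i → c (z , i)) (conn i j) ci≢cj
    ... | a , b , adj , ca≢cb = union {R₁ = _≡ z} here there
      (λ { refl z∈zs → All.lookup z∉zs z∈zs refl }) single (go zs! zsM)
      where
      single : Matching (_≡ z) c 1
      single = record
        { edges = ((z , a) , (z , b)) ∷ []
        ; good  = (inj₁ (refl , adj) , ca≢cb , refl , refl) ∷ []
        ; apart = [] ∷ []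
        ; size  = ≤-refl
        }

  -- For each i, the walk in layer i from u via the root to v changes colour.
  layered-matching : ∀ {R c} → PrefixClosed R → ∀ {u v} → R u → R v →
    (∀ i → c (u , i) ≢ c (v , i)) → Matching R c m
  layered-matching {R} {c} closed {u} {v} Ru Rv differ = record
    { edges = tabulate edge
    ; good  = All.tabulate⁺ λ i → proj₂ (descend i)
    ; apart = AllPairs.tabulate⁺ λ i≢j →
        (i≢j ∘ cong proj₂) , (i≢j ∘ cong proj₂) , (i≢j ∘ cong proj₂) , (i≢j ∘ cong proj₂)
    ; size  = ≤-reflexive (sym (length-tabulate edge))
    }
    where
    descend-to : ∀ i {u} → R u → c ([] , i) ≢ c (u , i) →
      ∃[ zd ] BichromaticEdge R c ((proj₁ zd , i) , (proj₁ zd ∷ʳ proj₂ zd , i))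
    descend-to i {u} Ru neq with bichromatic-descent (λ z → c (z , i)) u neq
    ... | z , d , zd⊑u , cz≢ = (z , d) , inj₂ (refl , inj₁ (d , refl)) , cz≢ ,
          closed (⊑-trans (d ∷ [] , refl) zd⊑u) Ru , closed zd⊑u Ru
    descend : ∀ i → ∃[ zd ] BichromaticEdge R c ((proj₁ zd , i) , (proj₁ zd ∷ʳ proj₂ zd , i))
    -- If the root agrees with u in layer i, it disagrees with v there, so one of the two descents
    -- from the root meets a colour change.
    descend i with c ([] , i) ≟C c (u , i)
    ... | no  neq = descend-to i Ru neq
    ... | yes eq  = descend-to i Rv (differ i ∘ trans (sym eq))
    edge : Fin m → Point m × Point m
    edge i = let ((z , d) , _) = descend i in (z , i) , (z ∷ʳ d , i)

  -- Either all the copies are mixed and yield an edge each, or one of them differs from u in every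
  -- layer and the m layers yield an edge each.
  mixed-or-opposite : Connected H → ∀ {R c p zs u} → p ≤ m → PrefixClosed R → R u →
    Unique zs → p ≤ length zs → All (λ z → R z × (Mixed c z ⊎ (∀ i → c (u , i) ≢ c (z , i)))) zs →
    Matching R c p
  mixed-or-opposite conn p≤m closed Ru zs! p≤zs zsM with all-or-one zsM
  ... | inj₁ mixed           = weaken id p≤zs (mixed-matching conn zs! mixed)
  ... | inj₂ (z , Rz , differ) = weaken id p≤m (layered-matching closed Ru Rz differ)

-- Occupied and monochromatic copies

module _ {m : ℕ} where

  Occupied : {A : Set} → (Point m → Maybe A) → Node → Set
  Occupied c z = ∃[ i ] Is-just (c (z , i))

  occupied? : {A : Set} (c : Point m → Maybe A) → Decidable (Occupied c)
  occupied? c z = Fin.any? λ i → MaybeAny.dec (λ _ → yes tt) (c (z , i))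

  Mono : Colouring m → Bool → Node → Set
  Mono c b z = ∀ i → c (z , i) ≡ just b

  mono? : (c : Colouring m) → ∀ b → Decidable (Mono c b)
  mono? c b z = Fin.all? λ i → c (z , i) ≟C just b

  occupied-mixed-or-full : ∀ {c z} → Occupied c z → Mixed c z ⊎ (∀ i → Is-just (c (z , i)))
  occupied-mixed-or-full {c} {z} (i , jᵢ) with Fin.all? (λ i → MaybeAny.dec (λ _ → yes tt) (c (z , i)))
  ... | yes full = inj₂ full
  ... | no ¬full with Fin.¬∀⟶∃¬ m _ (λ i → MaybeAny.dec (λ _ → yes tt) (c (z , i))) ¬full
  ...   | j , ¬jⱼ = inj₁ (i , j , λ eq → ¬jⱼ (subst Is-just eq jᵢ))

  non-mono⇒mixed : ∀ {c z} → Occupied c z → (∀ b → ¬ Mono c b z) → Mixed c z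
  non-mono⇒mixed {c} {z} (i , jᵢ) ¬mono with c (z , i) in eq
  non-mono⇒mixed {c} {z} (i , ()) ¬mono | nothing
  ... | just b with Fin.¬∀⟶∃¬ m _ (λ j → c (z , j) ≟C just b) (¬mono b)
  ...   | j , neq = i , j , λ eq′ → neq (trans (sym eq′) eq)

  mixed-or-mono : ∀ {c z} → Occupied c z → ∀ b → ¬ Mono c b z → Mixed c z ⊎ Mono c (not b) z
  mixed-or-mono {c} {z} occ b ¬mono with mono? c (not b) z
  ... | yes mono = inj₂ mono
  ... | no ¬mono′ = inj₁ (non-mono⇒mixed {c} {z} occ (neither b ¬mono ¬mono′))
    where
    neither : ∀ b → ¬ Mono c b z → ¬ Mono c (not b) z → ∀ b′ → ¬ Mono c b′ z
    neither true  t f true  = t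
    neither true  t f false = f
    neither false f t true  = t
    neither false f t false = f

  -- If some copy in us is not mixed, it lies entirely in the suffix. Every copy in vs is then mixed
  -- or lies entirely in the prefix, and in the latter case it differs from that copy in every
  -- layer.
  balanced-matching : (H : Graph m) → Connected H → ∀ {R c p us vs} → p ≤ m → PrefixClosed R →
    Unique us → p ≤ length us → All (λ z → R z × Occupied c z × ¬ Mono c true z) us →
    Unique vs → p ≤ length vs → All (λ z → R z × Occupied c z × ¬ Mono c false z) vs →
    Matching H R c p
  balanced-matching H conn {c = c} p≤m closed us! p≤us usN vs! p≤vs vsN
    with all-or-one (All.map (λ (Rz , occ , ¬t) → Rz , mixed-or-mono {c = c} occ true ¬t) usN)
  ... | inj₁ mixed = weaken H id p≤us (mixed-matching H conn us! mixed)
  ... | inj₂ (u , Ru , late) = mixed-or-opposite H conn p≤m closed Ru vs! p≤vs (All.map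
        (λ (Rz , occ , ¬f) → Rz , Sum.map₂
          (λ early i eq → true≢false (trans (sym (early i)) (trans (sym eq) (late i))))
          (mixed-or-mono {c = c} occ false ¬f)) vsN)
    where
    true≢false : _≢_ {A = Maybe Bool} (just true) (just false)
    true≢false ()

-- Schedules

<ᵇ-true : ∀ {n s} → n < s → (n <ᵇ s) ≡ true
<ᵇ-true n<s = Equivalence.to T-≡ (<⇒<ᵇ n<s)

<ᵇ-true⁻ : ∀ {n s} → (n <ᵇ s) ≡ true → n < s
<ᵇ-true⁻ {n} {s} eq = <ᵇ⇒< n s (Equivalence.from T-≡ eq)

<ᵇ-false : ∀ {n s} → ¬ n < s → (n <ᵇ s) ≡ false
<ᵇ-false {n} {s} n≮s with n <ᵇ s in eq
... | true  = contradiction (<ᵇ-true⁻ eq) n≮s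
... | false = refl

<ᵇ-false⁻ : ∀ {n s} → (n <ᵇ s) ≡ false → ¬ n < s
<ᵇ-false⁻ eq n<s with trans (sym eq) (<ᵇ-true n<s)
... | ()

-- The time at which a point enters the prefix, if it ever does.
Schedule : ℕ → Set
Schedule m = Point m → Maybe ℕ

-- At time s the prefix is just true, the suffix just false and the rest nothing.
colour : ∀ {m} → ℕ → Schedule m → Colouring m
colour s pos x = Maybe.map (_<ᵇ s) (pos x)

below : ∀ {m} → Node → Schedule m → Schedule m
below w pos x = pos (w ++ proj₁ x , proj₂ x)

-- Consequently at most one point changes colour between times s and s + 1.
Injective : ∀ {m} → Schedule m → Set
Injective pos = ∀ {x y n} → pos x ≡ just n → pos y ≡ just n → x ≡ y

BoundedBy : ∀ {m} → ℕ → Schedule m → Set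
BoundedBy L pos = ∀ {x n} → pos x ≡ just n → n < L

below-injective : ∀ {m} {pos : Schedule m} w → Injective pos → Injective (below w pos)
below-injective w inj eq eq′ with inj eq eq′
... | xy = cong₂ _,_ (++-cancelˡ w _ _ (cong proj₁ xy)) (cong proj₂ xy)

module _ {m : ℕ} (pos : Schedule m) where

  occupied-colour : ∀ s {z} → Occupied pos z → Occupied (colour s pos) z
  occupied-colour s {z} (i , jᵢ) = i , is-just-map jᵢ
    where
    is-just-map : ∀ {x} → Is-just x → Is-just (Maybe.map (_<ᵇ s) x)
    is-just-map (MaybeAny.just _) = MaybeAny.just tt

  colour-occupied : ∀ s x → Is-just (colour s pos x) → Is-just (pos x)
  colour-occupied s x j with pos x
  ... | just _ = MaybeAny.just tt

  colour-true : ∀ {s x} → colour s pos x ≡ just true → ∃[ n ] (pos x ≡ just n × n < s)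
  colour-true {s} {x} eq with pos x
  ... | just n = n , refl , <ᵇ-true⁻ (Maybe.just-injective eq)

  colour-false : ∀ {s x} → colour s pos x ≡ just false → ∃[ n ] (pos x ≡ just n × ¬ n < s)
  colour-false {s} {x} eq with pos x
  ... | just n = n , refl , <ᵇ-false⁻ (Maybe.just-injective eq)

  early-persists : ∀ {s s′ x} → s ≤ s′ → colour s pos x ≡ just true → colour s′ pos x ≡ just true
  early-persists {s} {s′} {x} s≤s′ eq with colour-true {s} {x} eq
  ... | n , pos≡ , n<s = trans (cong (Maybe.map (_<ᵇ s′)) pos≡) (cong just (<ᵇ-true (<-≤-trans n<s s≤s′)))

  late-persists : ∀ {s s′ x} → s ≤ s′ → colour s′ pos x ≡ just false → colour s pos x ≡ just false
  late-persists {s} {s′} {x} s≤s′ eq with colour-false {s′} {x} eq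
  ... | n , pos≡ , n≮s′ = trans (cong (Maybe.map (_<ᵇ s)) pos≡) (cong just (<ᵇ-false λ n<s → n≮s′ (<-≤-trans n<s s≤s′)))

  entry-time : ∀ {s x} → colour s pos x ≡ just false → colour (suc s) pos x ≡ just true → pos x ≡ just s
  entry-time {s} {x} late early with colour-false {s} {x} late | colour-true {suc s} {x} early
  ... | n , pos≡ , n≮s | n′ , pos≡′ , s≤s n′≤s with Maybe.just-injective (trans (sym pos≡) pos≡′)
  ...   | refl = trans pos≡ (cong just (≤-antisym n′≤s (≮⇒≥ n≮s)))

  nonmono? : ∀ s b → Decidable (λ z → ¬ Mono (colour s pos) b z)
  nonmono? s b z = ¬? (mono? (colour s pos) b z)

  Balanced : ℕ → ℕ → ℕ → Set
  Balanced p h s = p ≤ count (nonmono? s true) h × p ≤ count (nonmono? s false) h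

  -- The prefix only grows with time, so a copy entirely inside it stays inside.
  nonmono-true-antitone : ∀ {s s′} h → s ≤ s′ → count (nonmono? s′ true) h ≤ count (nonmono? s true) h
  nonmono-true-antitone {s} {s′} h s≤s′ = count-mono (nonmono? s′ true) (nonmono? s true)
    (λ ¬mono mono → ¬mono λ i → early-persists {s} {s′} s≤s′ (mono i)) h

  nonmono-false-monotone : ∀ {s s′} h → s ≤ s′ → count (nonmono? s false) h ≤ count (nonmono? s′ false) h
  nonmono-false-monotone {s} {s′} h s≤s′ = count-mono (nonmono? s false) (nonmono? s′ false)
    (λ ¬mono mono → ¬mono λ i → late-persists {s} {s′} s≤s′ (mono i)) h

-- Existence of a balanced time.

two-distinct : ∀ {m} → 2 ≤ m → ∃₂ λ (i j : Fin m) → i ≢ j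
two-distinct (s≤s (s≤s _)) = zero , suc zero , λ ()

-- The search runs downwards from n and stops at the first failure. It promises a consecutive pair
-- of times, not a failure of P at all earlier ones.
first-hit : {P : ℕ → Set} → Decidable P → ∀ n → P n → P 0 ⊎ ∃[ s ] (¬ P s × P (suc s))
first-hit P? zero    P0 = inj₁ P0
first-hit P? (suc n) Pn with P? n
... | yes Pn′ = first-hit P? n Pn′
... | no ¬Pn′ = inj₂ (n , ¬Pn′ , Pn)

-- Take the first time at which p copies are not entirely late. Just before it all but
-- p - 1 copies were entirely late, and one step cannot make any of those entirely early.
balanced-time : ∀ {m} (pos : Schedule m) → 2 ≤ m → Injective pos → ∀ {L} → BoundedBy L pos →
  ∀ p h → 2 * p ≤ ternarySize h → ∃[ s ] Balanced pos p h s
balanced-time {m} pos 2≤m inj {L} bounded p h 2p≤ with two-distinct 2≤m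
... | i , j , i≢j = choose (first-hit (λ s → p ≤? count (nonmono? pos s false) h) L
        (≤-trans p≤size (≤-reflexive (sym (count-all (nonmono? pos L false) h λ z _ → never-late)))))
  where
  p≤size : p ≤ ternarySize h
  p≤size = ≤-trans (m≤m+n p (p + 0)) 2p≤
  never-late : ∀ {z} → ¬ Mono (colour L pos) false z
  never-late mono with colour-false pos (mono i)
  ... | n , pos≡ , n≮L = n≮L (bounded pos≡)
  never-early : ∀ {z} → ¬ Mono (colour 0 pos) true z
  never-early mono with colour-true pos {0} (mono i)
  ... | n , pos≡ , ()
  one-step : ∀ {s z} → Mono (colour s pos) false z → ¬ Mono (colour (suc s) pos) true z
  -- The two distinct points i and j of the copy would both have to enter at time s.
  one-step late early = i≢j (cong proj₂ (inj (entry-time pos (late i) (early i)) (entry-time pos (late j) (early j))))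
  choose : _ → _
  -- At time 0 the prefix is empty, so no copy is entirely early.
  choose (inj₁ now) = 0 ,
    ≤-trans p≤size (≤-reflexive (sym (count-all (nonmono? pos 0 true) h λ z _ → never-early))) , now
  choose (inj₂ (s , before , now)) = suc s ,
    ≤-trans many-late (count-mono (mono? (colour s pos) false) (nonmono? pos (suc s) true) one-step h) , now
    where
    many-late : p ≤ count (mono? (colour s pos) false) h
    many-late = +-cancelʳ-≤ p p _ (begin
      p + p                       ≡⟨ cong (p +_) (sym (+-identityʳ p)) ⟩
      2 * p                       ≤⟨ 2p≤ ⟩
      ternarySize h               ≡⟨ count-∁ (mono? (colour s pos) false) h ⟩
      count (mono? (colour s pos) false) h + count (nonmono? pos s false) h ≤⟨ +-monoʳ-≤ _ (<⇒≤ (≰⇒> before)) ⟩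
      count (mono? (colour s pos) false) h + p ∎)
      where open ≤-Reasoning

-- Choosing subtrees by time and by size.

median : (f : Fin 3 → ℕ) → ∃[ a ] ∃[ b ] ∃[ c ] (a ≢ b × b ≢ c × f a ≤ f b × f b ≤ f c)
median f with ≤-total (f zero) (f (suc zero)) | ≤-total (f (suc zero)) (f (suc (suc zero)))
            | ≤-total (f zero) (f (suc (suc zero)))
... | inj₁ f0≤f1 | inj₁ f1≤f2 | _       = zero , suc zero , suc (suc zero) , (λ ()) , (λ ()) , f0≤f1 , f1≤f2
... | inj₁ f0≤f1 | inj₂ f2≤f1 | inj₁ f0≤f2 = zero , suc (suc zero) , suc zero , (λ ()) , (λ ()) , f0≤f2 , f2≤f1
... | inj₁ f0≤f1 | inj₂ f2≤f1 | inj₂ f2≤f0 = suc (suc zero) , zero , suc zero , (λ ()) , (λ ()) , f2≤f0 , f0≤f1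
... | inj₂ f1≤f0 | inj₁ f1≤f2 | inj₁ f0≤f2 = suc zero , zero , suc (suc zero) , (λ ()) , (λ ()) , f1≤f0 , f0≤f2
... | inj₂ f1≤f0 | inj₁ f1≤f2 | inj₂ f2≤f0 = suc zero , suc (suc zero) , zero , (λ ()) , (λ ()) , f1≤f2 , f2≤f0
... | inj₂ f1≤f0 | inj₂ f2≤f1 | _       = suc (suc zero) , suc zero , zero , (λ ()) , (λ ()) , f2≤f1 , f1≤f0

size-mono-≤ : ∀ {a b} → a ≤ b → ternarySize a ≤ ternarySize b
size-mono-≤ {zero}  {zero}  _         = ≤-refl
size-mono-≤ {zero}  {suc b} _         = s≤s z≤n
size-mono-≤ {suc a} {suc b} (s≤s a≤b) = s≤s (*-monoʳ-≤ 3 (size-mono-≤ a≤b))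

size-cancel-≤ : ∀ {a b} → ternarySize a ≤ ternarySize b → a ≤ b
size-cancel-≤ {zero}  {b}     _        = z≤n
size-cancel-≤ {suc a} {suc b} (s≤s le) = s≤s (size-cancel-≤ (*-cancelˡ-≤ 3 le))
size-cancel-≤ {suc a} {zero}  (s≤s le) = contradiction (≤-trans (*-monoʳ-≤ 3 (size-mono-≤ {0} {a} z≤n)) le) λ ()

pigeonhole : ∀ {N} (f : Fin 3 → ℕ) → 3 * N ≤ f zero + (f (suc zero) + f (suc (suc zero))) → ∃[ c ] N ≤ f c
pigeonhole {N} f le with Fin.any? (λ c → N ≤? f c)
... | yes found = found
... | no ¬found = contradiction (<-≤-trans
        (+-mono-< (small zero) (+-mono-< (small (suc zero)) (small (suc (suc zero)))))
        (≤-trans (≤-reflexive (cong (λ n → N + (N + n)) (sym (+-identityʳ N)))) le)) (<-irrefl refl)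
  where
  small : ∀ c → f c < N
  small c = ≰⇒> λ N≤ → ¬found (c , N≤)

-- Descend into a child subtree with at least N nodes of P as long as there is one. Where the
-- descent stops, each child subtree holds at most N - 1 of them, which leaves room within 3N for
-- the node itself.
moderate-subtree : {P : Node → Set} (P? : Decidable P) → ∀ N h → 1 ≤ N → N ≤ count P? h →
  ∃₂ λ w h′ → length w + h′ ≡ h × N ≤ count (λ z → P? (w ++ z)) h′ × count (λ z → P? (w ++ z)) h′ ≤ 3 * N
moderate-subtree P? N zero 1≤N N≤ = [] , 0 , refl , N≤ ,
  ≤-trans (count≤size P? 0) (≤-trans 1≤N (m≤m+n N _))
moderate-subtree P? N (suc h) 1≤N N≤ with Fin.any? (λ c → N ≤? count (λ z → P? (c ∷ z)) h)
... | yes (c , N≤c) with moderate-subtree (λ z → P? (c ∷ z)) N h 1≤N N≤c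
...   | w , h′ , refl , N≤w , w≤3N = c ∷ w , h′ , refl , N≤w , w≤3N
moderate-subtree P? N (suc h) 1≤N N≤ | no ¬big = [] , suc h , refl , N≤ ,
  ≤-trans (count-suc P? h) (≤-trans
    (+-mono-≤ (small zero) (+-mono-≤ (<⇒≤ (small (suc zero))) (<⇒≤ (small (suc (suc zero))))))
    (≤-reflexive (cong (λ n → N + (N + n)) (sym (+-identityʳ N)))))
  where
  small : ∀ c → count (λ z → P? (c ∷ z)) h < N
  small c = ≰⇒> λ N≤c → ¬big (c , N≤c)

another : (d : Fin 3) → ∃[ e ] e ≢ d
another zero    = suc zero , λ ()
another (suc d) = zero , λ ()

-- If the only child subtree with N nodes of P contains the given node outside P, then any
-- other child subtree has too few nodes of P to be contained in P.
separated-child : {P : Node → Set} (P? : Decidable P) → ∀ N h → 1 + 3 * N ≤ count P? (suc h) →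
  ∃[ z ] (Within (suc h) z × ¬ P z) →
  ∃[ c ] (N ≤ count (λ z → P? (c ∷ z)) h × ∃[ u ] (Within (suc h) u × ¬ P u × ¬ (c ∷ []) ⊑ u))
separated-child {P} P? N h le (z₀ , z₀≤h , ¬Pz₀)
  with pigeonhole {N} (λ c → count (λ z → P? (c ∷ z)) h) (≤-pred (≤-trans le (count-suc P? h)))
separated-child P? N h le ([] , z₀≤h , ¬Pz₀) | c , N≤c = c , N≤c , [] , z₀≤h , ¬Pz₀ , λ ()
separated-child P? N h le (d ∷ y , z₀≤h , ¬Pz₀) | c , N≤c with c ≟F d
... | no c≢d = c , N≤c , d ∷ y , z₀≤h , ¬Pz₀ , λ { (_ , refl) → c≢d refl }
... | yes refl with another d
...   | e , e≢d with N ≤? count (λ z → P? (e ∷ z)) h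
...     | yes N≤e = e , N≤e , d ∷ y , z₀≤h , ¬Pz₀ , λ { (_ , refl) → e≢d refl }
...     | no ¬N≤e
  -- The subtree at d contains N nodes of P, so every child subtree has at least N nodes; the one at
  -- e has fewer than N in P and must contain a node outside P.
  with missing (λ z → P? (e ∷ z)) h (<-≤-trans (≰⇒> ¬N≤e) (≤-trans N≤c (count≤size (λ z → P? (d ∷ z)) h)))
...       | u , u≤h , ¬Pu = d , N≤c , e ∷ u , s≤s u≤h , ¬Pu , λ { (_ , refl) → e≢d refl }

-- The induction on the number of blocks of p edges.

module _ {m : ℕ} (H : Graph m) (conn : Connected H) (p t : ℕ) (1≤p : 1 ≤ p) (2p≤m : 2 * p ≤ m)
         (p<size : p < ternarySize (suc t)) where

  private
    p≤m : p ≤ m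
    p≤m = ≤-trans (m≤m+n p (p + 0)) 2p≤m

    -- A tree of height t + 2 has more than 3p nodes, which is why the full trees below start at
    -- this height: a balanced time requires 2p copies.
    2p≤size : 2 * p ≤ ternarySize (2 + t)
    2p≤size = ≤-trans (*-mono-≤ {2} {3} (s≤s (s≤s z≤n)) (<⇒≤ p<size)) (n≤1+n _)

  -- At the middle time, the subtree that was balanced earlier has p copies not entirely late,
  -- and the one that will be balanced later has p copies not entirely early.
  full-tree : ∀ j (pos : Schedule m) → Injective pos → ∀ {L} → BoundedBy L pos →
    (∀ z → Within (j + (2 + t)) z → Occupied pos z) →
    ∃[ s ] (Balanced pos p (j + (2 + t)) s × Matching H (Within (j + (2 + t))) (colour s pos) (suc j * p))
  full-tree zero pos inj bounded occ
    with balanced-time pos (≤-trans (*-monoʳ-≤ 2 1≤p) 2p≤m) inj bounded p (2 + t) 2p≤size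
  ... | s , bal@(p≤t , p≤f) = s , bal , weaken H id (≤-reflexive (+-identityʳ p))
    (balanced-matching H conn p≤m within-closed
      (filter-nodes-unique (nonmono? pos s true) (2 + t)) p≤t
      (All.map occupy (filter-nodes-all (nonmono? pos s true) (2 + t)))
      (filter-nodes-unique (nonmono? pos s false) (2 + t)) p≤f
      (All.map occupy (filter-nodes-all (nonmono? pos s false) (2 + t))))
    where
    occupy : ∀ {z} {A : Set} → Within (2 + t) z × A → Within (2 + t) z × Occupied (colour s pos) z × A
    occupy (z≤h , a) = z≤h , occupied-colour pos s (occ _ z≤h) , a
  full-tree (suc j) pos inj {L} bounded occ = combine (median (proj₁ ∘ rec))
    where
    h = j + (2 + t)
    rec : ∀ c → ∃[ s ] (Balanced (below (c ∷ []) pos) p h s ×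
                        Matching H (Within h) (colour s (below (c ∷ []) pos)) (suc j * p))
    rec c = full-tree j (below (c ∷ []) pos) (below-injective (c ∷ []) inj) bounded λ z z≤h → occ (c ∷ z) (s≤s z≤h)
    combine : _ → _
    combine (a , b , c , a≢b , b≢c , sa≤sb , sb≤sc) = s , (
        -- The copies in the subtree at b alone already make time s balanced for the whole tree.
        ≤-trans (proj₁ balᵇ) (count-∷≤count (nonmono? pos s true) h b) ,
        ≤-trans (proj₂ balᵇ) (count-∷≤count (nonmono? pos s false) h b)) ,
      union H proj₁ (λ { (y , y≤h , refl) → s≤s y≤h }) (λ { (_ , b⋢z) (y , _ , refl) → b⋢z (y , refl) })
        outside (graft H (b ∷ []) (proj₂ (proj₂ (rec b))))
      where
      s = proj₁ (rec b)
      balᵇ = proj₁ (proj₂ (rec b))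
      copies : Fin 3 → Bool → List Node
      copies d e = filter (nonmono? (below (d ∷ []) pos) s e) (nodes h)
      moved : ∀ {d} e → d ≢ b →
        All (λ z → Outside (suc h) (b ∷ []) z × Occupied (colour s pos) z × ¬ Mono (colour s pos) e z)
            (map (d ∷_) (copies d e))
      moved {d} e d≢b = All.map⁺ (All.map (λ (z≤h , ¬mono) → (s≤s z≤h , λ { (_ , refl) → d≢b refl }) ,
        occupied-colour pos s (occ _ (s≤s z≤h)) , ¬mono) (filter-nodes-all (nonmono? (below (d ∷ []) pos) s e) h))
      unique : ∀ d e → Unique (map (d ∷_) (copies d e))
      unique d e = Unique.map⁺ ∷-injectiveʳ (filter-nodes-unique (nonmono? (below (d ∷ []) pos) s e) h)
      outside : Matching H (Outside (suc h) (b ∷ [])) (colour s pos) p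
      outside = balanced-matching H conn p≤m outside-closed
        (unique c true) (subst (p ≤_) (sym (length-map (c ∷_) (copies c true)))
          (≤-trans (proj₁ (proj₁ (proj₂ (rec c)))) (nonmono-true-antitone (below (c ∷ []) pos) h sb≤sc)))
        (moved true (b≢c ∘ sym))
        (unique a false) (subst (p ≤_) (sym (length-map (a ∷_) (copies a false)))
          (≤-trans (proj₂ (proj₁ (proj₂ (rec a)))) (nonmono-false-monotone (below (a ∷ []) pos) h sa≤sb)))
        (moved false a≢b)

  -- When every copy is occupied, each level above height t + 2 brings p more edges, whereas only p
  -- edges for every two levels are asked for here.
  tall-full-tree : ∀ k h (pos : Schedule m) → Injective pos → ∀ {L} → BoundedBy L pos →
    suc k * 2 + t ≤ h → (∀ z → Within h z → Occupied pos z) →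
    ∃[ s ] Matching H (Within h) (colour s pos) (suc k * p)
  tall-full-tree k h pos inj bounded le occ with m≤n⇒∃[o]m+o≡n le
  ... | o , eq with trans (rearrange k t o) eq
    where
    rearrange : ∀ k t o → (k * 2 + o) + (2 + t) ≡ (suc k * 2 + t) + o
    rearrange = +-*-Solver.solve 3
      (λ k t o → (k :* con 2 :+ o) :+ (con 2 :+ t) := ((con 1 :+ k) :* con 2 :+ t) :+ o) refl
      where open +-*-Solver
  ...   | refl with full-tree (k * 2 + o) pos inj bounded occ
  ...     | s , _ , M = s , weaken H id (*-monoˡ-≤ p (s≤s (≤-trans (m≤m*n k 2) (m≤m+n (k * 2) o)))) M

  -- Induction on k, each step using two levels. With N = `ternarySize (k * 2 + t)`, already 1 + 3N
  -- occupied copies suffice to find a child subtree that holds N of them and leaves an unoccupied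
  -- copy outside. The second level ensures that p occupied copies remain outside the subtree used
  -- for the recursion.
  large-occupation : ∀ k h (pos : Schedule m) → Injective pos → ∀ {L} → BoundedBy L pos →
    ternarySize (k * 2 + t) ≤ count (occupied? pos) h →
    ∃[ s ] Matching H (Within h) (colour s pos) (k * p)
  large-occupation zero    h pos inj bounded _ = 0 , empty-matching H
  large-occupation (suc k) zero pos inj bounded le =
    contradiction (≤-trans le (count≤size (occupied? pos) 0)) (λ { (s≤s ()) })
  large-occupation (suc k) (suc h) pos inj bounded le with all-or-missing (occupied? pos) (suc h)
  ... | inj₁ occ = tall-full-tree k (suc h) pos inj bounded
        (size-cancel-≤ (≤-trans le (count≤size (occupied? pos) (suc h)))) occ
  ... | inj₂ unoccupied with separated-child (occupied? pos) N h (≤-trans (s≤s (*-monoʳ-≤ 3 N≤)) le) unoccupied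
    where
    N = ternarySize (k * 2 + t)
    N≤ : N ≤ 1 + 3 * N
    N≤ = ≤-trans (m≤m+n N _) (n≤1+n _)
  ...   | c , N≤c , u , u≤h , ¬occ-u , c⋢u
    with moderate-subtree (λ z → occupied? pos (c ∷ z)) (ternarySize (k * 2 + t)) h (size-mono-≤ {0} {k * 2 + t} z≤n) N≤c
  ...     | w , h′ , refl , N≤w , w≤3N
    with large-occupation k h′ (below (c ∷ w) pos) (below-injective (c ∷ w) inj) bounded N≤w
  ...       | s , M = s , union H proj₁ inside⊆ (λ { (_ , cw⋢z) (y , _ , refl) → cw⋢z (y , refl) })
                outside (graft H (c ∷ w) M)
    where
    N = ternarySize (k * 2 + t)
    inside⊆ : ∀ {z} → ∃[ y ] (Within h′ y × z ≡ c ∷ w ++ y) → Within (suc h) z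
    inside⊆ (y , y≤h′ , refl) = s≤s (subst (_≤ length w + h′) (sym (length-++ w)) (+-monoʳ-≤ (length w) y≤h′))
    p≤3N : p ≤ 3 * N
    p≤3N = ≤-trans (≤-pred p<size) (*-monoʳ-≤ 3 (size-mono-≤ (m≤n+m t (k * 2))))
    -- There are at least 4 + 9N occupied copies, and at most 3N of them lie below `c ∷ w`. At least
    -- 3N remain, hence at least p.
    enough : p ≤ length (filter-outside (occupied? pos) (suc h) (c ∷ w))
    enough = +-cancelˡ-≤ (3 * N) p _ (begin
      3 * N + p                    ≤⟨ +-monoʳ-≤ (3 * N) p≤3N ⟩
      3 * N + 3 * N                ≤⟨ +-mono-≤ (n≤1+n (3 * N)) (≤-trans (n≤1+n (3 * N)) (m≤m+n (1 + 3 * N) _)) ⟩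
      3 * (1 + 3 * N)              ≤⟨ n≤1+n _ ⟩
      1 + 3 * (1 + 3 * N)          ≤⟨ le ⟩
      count (occupied? pos) (suc h) ≤⟨ count≤inside+outside (occupied? pos) (c ∷ w) h′ ⟩
      count (λ z → occupied? pos (c ∷ w ++ z)) h′ + length (filter-outside (occupied? pos) (suc h) (c ∷ w))
                                   ≤⟨ +-monoˡ-≤ _ w≤3N ⟩
      3 * N + length (filter-outside (occupied? pos) (suc h) (c ∷ w)) ∎)
      where open ≤-Reasoning
    -- The copy at u contains nothing of V at any time, so whichever time s the recursion returns
    -- will do. An occupied copy that also has a vertex outside V is mixed; one contained in V
    -- differs from u in every layer.
    classify : ∀ {z} → Occupied pos z →
      Mixed (colour s pos) z ⊎ (∀ i → colour s pos (u , i) ≢ colour s pos (z , i))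
    classify occ = Sum.map₂
      (λ full i eq → ¬occ-u (i , colour-occupied pos s (u , i) (subst Is-just (sym eq) (full i))))
      (occupied-mixed-or-full {c = colour s pos} (occupied-colour pos s occ))
    outside : Matching H (Outside (suc h) (c ∷ w)) (colour s pos) p
    outside = mixed-or-opposite H conn p≤m outside-closed
      (u≤h , λ cw⊑u → c⋢u (⊑-trans (w , refl) cw⊑u))
      (Unique.filter⁺ _ (filter-nodes-unique (occupied? pos) (suc h))) enough
      (All.map (map₂ classify) (outside-all (occupied? pos) (suc h) (c ∷ w)))

-- Transfer to T(H)

module _ {h m : ℕ} where

  point : TH-Vertex h m → Point m
  point ((w , _) , i) = w , i

  point-injective : ∀ {v v′} → point v ≡ point v′ → v ≡ v′
  point-injective {(w , le) , i} {(_ , le′) , _} refl = cong (λ q → (w , q) , i) (≤-irrelevant le le′)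

  _≟P_ : (x y : Point m) → Dec (x ≡ y)
  _≟P_ = Product.≡-dec (≡-dec _≟F_) _≟F_

  -- The position of the first occurrence, counted from 0, so that time s corresponds to the split
  -- into `take s` and `drop s`.
  entry : List (TH-Vertex h m) → Schedule m
  entry []       x = nothing
  entry (v ∷ vs) x with point v ≟P x
  ... | yes _ = just 0
  ... | no  _ = Maybe.map suc (entry vs x)

  entry-injective : ∀ vs → Injective (entry vs)
  entry-injective (v ∷ vs) {x} {y} eq eq′ with point v ≟P x | point v ≟P y
  entry-injective (v ∷ vs) {x} {y} eq eq′ | yes refl | yes refl = refl
  entry-injective (v ∷ vs) {x} {y} refl eq′ | yes _ | no _ with entry vs y
  entry-injective (v ∷ vs) {x} {y} refl () | yes _ | no _ | just _
  entry-injective (v ∷ vs) {x} {y} refl () | yes _ | no _ | nothing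
  entry-injective (v ∷ vs) {x} {y} eq refl | no _ | yes _ with entry vs x
  entry-injective (v ∷ vs) {x} {y} () refl | no _ | yes _ | just _
  entry-injective (v ∷ vs) {x} {y} () refl | no _ | yes _ | nothing
  entry-injective (v ∷ vs) {x} {y} eq eq′ | no _ | no _ with entry vs x in eqx | entry vs y in eqy
  entry-injective (v ∷ vs) {x} {y} refl refl | no _ | no _ | just n | just .n = entry-injective vs eqx eqy

  entry-bounded : ∀ vs → BoundedBy (length vs) (entry vs)
  entry-bounded (v ∷ vs) {x} eq with point v ≟P x
  entry-bounded (v ∷ vs) {x} refl | yes _ = s≤s z≤n
  ... | no _ with entry vs x in eqx
  entry-bounded (v ∷ vs) {x} refl | no _ | just n = s≤s (entry-bounded vs eqx)

  entry-take : ∀ vs {v n s} → entry vs (point v) ≡ just n → n < s → v ∈ take s vs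
  entry-take (v′ ∷ vs) {v} eq (s≤s n≤s) with point v′ ≟P point v
  ... | yes same = here (sym (point-injective same))
  ... | no _ with entry vs (point v) in eqv
  entry-take (v′ ∷ vs) {v} refl (s≤s n<s) | no _ | just n = there (entry-take vs eqv n<s)

  entry-drop : ∀ vs {v n s} → entry vs (point v) ≡ just n → s ≤ n → v ∈ drop s vs
  entry-drop (v′ ∷ vs) {v} eq s≤n with point v′ ≟P point v
  entry-drop (v′ ∷ vs) refl z≤n | yes same = here (sym (point-injective same))
  ... | no _ with entry vs (point v) in eqv
  entry-drop (v′ ∷ vs) refl z≤n       | no _ | just n = there (entry-drop vs eqv z≤n)
  entry-drop (v′ ∷ vs) refl (s≤s s≤n) | no _ | just n = entry-drop vs eqv s≤n

  entry-just : ∀ {vs v} → v ∈ vs → Is-just (entry vs (point v))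
  entry-just {v′ ∷ vs} {v} v∈ with point v′ ≟P point v
  ... | yes _ = MaybeAny.just tt
  entry-just {v′ ∷ vs} {v} (here refl) | no differ = contradiction refl differ
  entry-just {v′ ∷ vs} {v} (there v∈)  | no _ with entry vs (point v) | entry-just v∈
  ... | just _ | _ = MaybeAny.just tt

  entry-nothing : ∀ {vs v} → entry vs (point v) ≡ nothing → v ∉ vs
  entry-nothing eq v∈ with subst Is-just eq (entry-just v∈)
  ... | ()

  occupiedCount≤count : (vs : List (TH-Vertex h m)) → occupiedCount vs ≤ count (occupied? (entry vs)) h
  occupiedCount≤count vs = length≤count (occupied? (entry vs))
    (deduplicate-! (≡-dec _≟F_) (map (λ x → proj₁ (proj₁ x)) vs)) (All.tabulate witness)
    where
    witness : ∀ {z} → z ∈ deduplicate (≡-dec _≟F_) (map (λ x → proj₁ (proj₁ x)) vs) →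
      Within h z × Occupied (entry vs) z
    witness z∈ with ∈-map⁻ _ (∈-deduplicate⁻ (≡-dec _≟F_) (map (λ x → proj₁ (proj₁ x)) vs) z∈)
    ... | ((w , w≤h) , i) , v∈ , refl = w≤h , i , entry-just v∈

  bichromatic⇒supported : ∀ vs s a b → colour s (entry vs) (point a) ≢ colour s (entry vs) (point b) →
    SupportedEdge (take s vs) (drop s vs) (a , b)
  bichromatic⇒supported vs s a b neq with entry vs (point a) in eqa | entry vs (point b) in eqb
  ... | nothing | nothing = contradiction refl neq
  -- Every position is at least 0 and `drop 0 vs` is `vs`, so `entry-drop` with `z≤n` yields
  -- membership in V, here and in the next case.
  ... | nothing | just n = inj₂ (inj₂ (inj₂ (
          subst (a ∉_) (sym (take++drop≡id s vs)) (entry-nothing eqa) ,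
          subst (b ∈_) (sym (take++drop≡id s vs)) (entry-drop vs eqb z≤n))))
  ... | just n | nothing = inj₂ (inj₂ (inj₁ (
          subst (a ∈_) (sym (take++drop≡id s vs)) (entry-drop vs eqa z≤n) ,
          subst (b ∉_) (sym (take++drop≡id s vs)) (entry-nothing eqb))))
  ... | just n | just n′ with n <? s | n′ <? s
  ...   | yes n<s | yes n′<s = contradiction (cong just (trans (<ᵇ-true n<s) (sym (<ᵇ-true n′<s)))) neq
  ...   | yes n<s | no  n′≮s = inj₁ (entry-take vs eqa n<s , entry-drop vs eqb (≮⇒≥ n′≮s))
  ...   | no  n≮s | yes n′<s = inj₂ (inj₁ (entry-drop vs eqa (≮⇒≥ n≮s) , entry-take vs eqb n′<s))
  ...   | no  n≮s | no  n′≮s = contradiction (cong just (trans (<ᵇ-false n≮s) (sym (<ᵇ-false n′≮s)))) neq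

  module _ (H : Graph m) {c : Colouring m} where

    toEdge : ∀ {e} → BichromaticEdge H (Within h) c e → Edge h m
    toEdge {(u , i) , (v , j)} (_ , _ , u≤h , v≤h) = ((u , u≤h) , i) , ((v , v≤h) , j)

    -- The recursion follows the evidence and not just the list, because the length bounds needed
    -- for a `TVertex` are stored in the evidence.
    toEdges : ∀ {es} → All (BichromaticEdge H (Within h) c) es → List (Edge h m)
    toEdges []       = []
    toEdges (g ∷ gs) = toEdge g ∷ toEdges gs

    length-toEdges : ∀ {es} (gs : All (BichromaticEdge H (Within h) c) es) → length (toEdges gs) ≡ length es
    length-toEdges []       = refl
    length-toEdges (g ∷ gs) = cong suc (length-toEdges gs)

    toEdges-adj : ∀ {es} (gs : All (BichromaticEdge H (Within h) c) es) →
      All (λ e → TH-Adj H (proj₁ e) (proj₂ e)) (toEdges gs)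
    toEdges-adj [] = []
    toEdges-adj ((inj₁ (u≡v , adj) , _) ∷ gs) = inj₁ (tvertex u≡v , adj) ∷ toEdges-adj gs
      where
      tvertex : ∀ {u v} {u≤h : Within h u} {v≤h : Within h v} → u ≡ v → _≡_ {A = TVertex h} (u , u≤h) (v , v≤h)
      tvertex {u} refl = cong (u ,_) (≤-irrelevant _ _)
    toEdges-adj ((inj₂ adj , _) ∷ gs) = inj₂ adj ∷ toEdges-adj gs

    toEdges-unique : ∀ {es} (gs : All (BichromaticEdge H (Within h) c) es) → AllPairs (Apart H) es →
      Unique (endpoints (toEdges gs))
    toEdges-unique []       []       = []
    toEdges-unique ((_ , ca≢cb , _) ∷ gs) (a ∷ as) =
      ((ca≢cb ∘ cong (c ∘ point)) ∷ separate gs (All.map (λ (p , q , _ , _) → p , q) a)) ∷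
      separate gs (All.map (λ (_ , _ , p , q) → p , q) a) ∷
      toEdges-unique gs as
      where
      separate : ∀ {v es} (gs : All (BichromaticEdge H (Within h) c) es) →
        All (λ e → point v ≢ proj₁ e × point v ≢ proj₂ e) es → All (v ≢_) (endpoints (toEdges gs))
      separate []       []             = []
      separate (g ∷ gs) ((p , q) ∷ ps) = (p ∘ cong point) ∷ (q ∘ cong point) ∷ separate gs ps

  toEdges-supported : (H : Graph m) → ∀ vs s {es} (gs : All (BichromaticEdge H (Within h) (colour s (entry vs))) es) →
    All (SupportedEdge (take s vs) (drop s vs)) (toEdges H gs)
  toEdges-supported H vs s []       = []
  toEdges-supported H vs s ((_ , neq , _) ∷ gs) =
    bichromatic⇒supported vs s _ _ neq ∷ toEdges-supported H vs s gs

theorem1 : (p h m : ℕ) → 1 ≤ p → (H : Graph m) → Connected H → 2 * p ≤ m →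
    (SV : List (TH-Vertex h m)) → Unique SV →
    p ≤ occupiedCount SV →
    (x t : ℕ) → IsTr (occupiedCount SV) x → IsTr p t →
    ∃[ M ] (Witnessing H SV M × p * ((x ∸ t) / 2) ≤ length M)
theorem1 p h m 1≤p H conn 2p≤m SV SV! p≤occ x t (x-size , x-max) (t-size , t-max)
  -- If p were at least `ternarySize (suc t)`, maximality of t would force t + 1 ≤ t.
  with large-occupation H conn p t 1≤p 2p≤m (≰⇒> (λ le → <-irrefl refl (t-max (suc t) le)))
         ((x ∸ t) / 2) h (entry SV) (entry-injective SV) (entry-bounded SV) occupied-enough
  where
  t≤x : t ≤ x
  t≤x = x-max t (≤-trans t-size p≤occ)
  occupied-enough : ternarySize ((x ∸ t) / 2 * 2 + t) ≤ count (occupied? (entry SV)) h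
  -- Rounding down gives 2k ≤ x - t for k = (x - t) / 2, and since t ≤ x this means 2k + t ≤ x.
  occupied-enough = ≤-trans (size-mono-≤ (≤-trans (+-monoˡ-≤ t (m/n*n≤m (x ∸ t) 2)) (≤-reflexive (m∸n+n≡m t≤x))))
    (≤-trans x-size (occupiedCount≤count SV))
... | s , M = toEdges H (good M) ,
  ((toEdges-adj H (good M) , toEdges-unique H (good M) (apart M)) ,
   take s SV , drop s SV , sym (take++drop≡id s SV) , toEdges-supported H SV s (good M)) ,
  ≤-trans (≤-reflexive (*-comm p _)) (≤-trans (size M) (≤-reflexive (sym (length-toEdges H (good M)))))
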